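{- For every numbering $\phi$ with the Kolmogorov property and every positive integer $k$, the set $\mathrm{MIN}_\phi$ is not $(1,k)$-recursive.
   Context: A numbering $\phi$ is given by a partial-recursive function $U:\mathbb{N}^2\to\mathbb{N}$ via $\phi_e(x)=U(e,x)$. $\phi$ has the Kolmogorov property if for every numbering $\psi$ there exist a constant $c>0$ and a (not necessarily computable) function $f$ with $f(e)\le ce+c$ and $\phi_{f(e)}=\psi_e$ for all $e$. $\mathrm{MIN}_\phi=\{e:(\forall j<e)\,[\phi_j\ne\phi_e]\}$. A set $A$ is $(1,k)$-recursive if there is a computable function $f$ mapping $k$-tuples to label vectors in $\{0,1\}^k$ such that for every tuple $(x_1,\dots,x_k)$ the vectors $(\chi_A(x_1),\dots,\chi_A(x_k))$ and $f(x_1,\dots,x_k)$ agree in at least one position. -}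

module Defs where

open import Data.Nat using (ℕ; zero; suc; _+_; _*_; _≤_; _<_)
open import Data.Fin using (Fin)
open import Data.Vec using (Vec; []; _∷_; lookup)
open import Data.Product using (Σ; ∃; ∃₂; _×_; _,_)
open import Data.Sum using (_⊎_)
open import Relation.Nullary using (¬_)
open import Relation.Binary.PropositionalEquality using (_≡_)

data PR : ℕ → Set where
  zeroF : ∀ {n} → PR n
  succF : PR 1
  projF : ∀ {n} → Fin n → PR n
  compF : ∀ {n m} → PR m → Vec (PR n) m → PR n
  recF  : ∀ {n} → PR n → PR (suc (suc n)) → PR (suc n)
  minF  : ∀ {n} → PR (suc n) → PR n

data Eval : ∀ {n} → PR n → Vec ℕ n → ℕ → Set
data EvalAll : ∀ {n m} → Vec (PR n) m → Vec ℕ n → Vec ℕ m → Set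

data Eval where
  ev-zero : ∀ {n} {xs : Vec ℕ n} → Eval zeroF xs 0
  ev-succ : ∀ {x} → Eval succF (x ∷ []) (suc x)
  ev-proj : ∀ {n} {i : Fin n} {xs} → Eval (projF i) xs (lookup xs i)
  ev-comp : ∀ {n m} {f : PR m} {gs : Vec (PR n) m} {xs ys z} →
            EvalAll gs xs ys → Eval f ys z → Eval (compF f gs) xs z
  ev-rec0 : ∀ {n} {f : PR n} {g} {xs z} →
            Eval f xs z → Eval (recF f g) (0 ∷ xs) z
  ev-recS : ∀ {n} {f : PR n} {g} {xs y z w} →
            Eval (recF f g) (y ∷ xs) z → Eval g (y ∷ z ∷ xs) w →
            Eval (recF f g) (suc y ∷ xs) w
  ev-min  : ∀ {n} {f : PR (suc n)} {xs y} →
            Eval f (y ∷ xs) 0 →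
            (∀ z → z < y → ∃ λ v → Eval f (z ∷ xs) (suc v)) →
            Eval (minF f) xs y

data EvalAll where
  []  : ∀ {n} {xs : Vec ℕ n} → EvalAll [] xs []
  _∷_ : ∀ {n m} {g : PR n} {gs : Vec (PR n) m} {xs y ys} →
        Eval g xs y → EvalAll gs xs ys → EvalAll (g ∷ gs) xs (y ∷ ys)

-- A numbering is given by a partial recursive U : ℕ² → ℕ, φ_e(x) = U(e, x).
Numbering : Set
Numbering = PR 2

_⟨_⟩_⇓_ : Numbering → ℕ → ℕ → ℕ → Set
U ⟨ e ⟩ x ⇓ y = Eval U (e ∷ x ∷ []) y

SameFn : Numbering → ℕ → Numbering → ℕ → Set
SameFn φ i ψ j = ∀ x y → (φ ⟨ i ⟩ x ⇓ y → ψ ⟨ j ⟩ x ⇓ y) × (ψ ⟨ j ⟩ x ⇓ y → φ ⟨ i ⟩ x ⇓ y)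

Kolmogorov : Numbering → Set
Kolmogorov φ = ∀ (ψ : Numbering) →
  Σ ℕ λ c → Σ (ℕ → ℕ) λ f →
    (0 < c) × (∀ e → f e ≤ c * e + c) × (∀ e → SameFn φ (f e) ψ e)

MIN : Numbering → ℕ → Set
MIN φ e = ∀ j → j < e → ¬ SameFn φ j φ e

AgreesChar : (ℕ → Set) → ℕ → ℕ → Set
AgreesChar A x b = (b ≡ 1 × A x) ⊎ (b ≡ 0 × ¬ A x)

-- A is (1,k)-recursive: a computable (total) f : ℕ^k → {0,1}^k, given by its
-- k component functions, such that for every k-tuple some position is correct.
OneKRecursive : (ℕ → Set) → ℕ → Set
OneKRecursive A k = Σ (Fin k → PR k) λ g →
  ∀ (xs : Vec ℕ k) →
    (∀ i → ∃ λ b → Eval (g i) xs b × b ≤ 1) ×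
    (∃ λ i → ∃ λ b → Eval (g i) xs b × AgreesChar A (lookup xs i) b)

{-# OPTIONS --safe #-}
module Submission where

-- MIN has positive lower density (the constant functions have distinct minimal indices of linear
-- size), while a computable map t can take a value in MIN only at arguments e with t(e) = O(e)
-- (apply the Kolmogorov property to φ_{t(e)}).  So it is enough to compute, for windows of
-- consecutive integers starting at a and of length proportional to a, a set of at most √a elements
-- that meets MIN.  If MIN were (1,k)-recursive, the predictions on the k-tuples would leave only
-- polynomially many candidates for the trace of MIN on the window, by the Sauer-Shelah lemma, and
-- then a greedy choice gives O(log a) elements meeting every candidate of the right density.

open import Defs
open import Data.Bool using (Bool; true; false; not; _∧_; _∨_)
open import Data.Fin using (Fin; zero; suc; toℕ; fromℕ<; _↑ˡ_; _↑ʳ_)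
open import Data.Fin.Patterns using (0F; 1F; 2F)
open import Data.Fin.Properties using (toℕ<n; toℕ-injective; toℕ-fromℕ<; sequence)
open import Data.Nat
open import Data.Nat.Induction using (<-rec)
open import Data.Nat.Properties
open import Data.Nat.Solver using (module +-*-Solver)
open import Data.Product using (∃; _×_; _,_; proj₁; proj₂)
open import Data.Sum using (_⊎_; inj₁; inj₂)
open import Data.Vec using (Vec; []; _∷_; lookup; tabulate; head; tail; map; _++_)
open import Data.Vec.Properties
  using (lookup∘tabulate; tabulate∘lookup; tabulate-cong; lookup-++ˡ; lookup-++ʳ; lookup-map; map-∘)
open import Data.Vec.Relation.Unary.All using (All; []; _∷_; universal)
import Data.Vec.Relation.Unary.All.Properties as All
open import Effect.Monad using (RawMonad)
open import Function using (_∘_; id)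
open import Relation.Binary.Definitions using (tri<; tri≈; tri>)
open import Relation.Binary.PropositionalEquality
open import Relation.Nullary using (¬_; Dec; does; yes; no; contradiction)
open import Relation.Nullary.Decidable using (decidable-stable; ¬¬-excluded-middle; dec-true)
open import Relation.Nullary.Negation using (¬¬-Monad)

-- The trace of `MIN φ` on a window cannot be computed, so the hitting set has to serve every
-- candidate trace at once. Whether a given finite set does so is a decidable question about the
-- predictions, and unbounded search finds such a set whenever one exists. The counting argument
-- provides existence only at levels where a cost linear in s is at most `2 ^ s`; below them the
-- search may diverge. This is harmless, because the linear bound derived from the Kolmogorov
-- property concerns only the arguments where the program converges. The contradiction is one of
-- growth: the indices of block s lie below `2 ^ suc s`, while the window starts at the square of
-- `2 ^ s`, so a minimal value obtained there is at least quadratic in its index. Membership in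
-- `MIN φ` is undecidable, so least indices and characteristic vectors exist only under double
-- negation. That suffices, because the places where they are used conclude either a negation or an
-- inequality between numbers, and both are stable.

Eval-deterministic : ∀ {n} {f : PR n} {xs y z} → Eval f xs y → Eval f xs z → y ≡ z
EvalAll-deterministic : ∀ {n m} {gs : Vec (PR n) m} {xs ys zs} →
  EvalAll gs xs ys → EvalAll gs xs zs → ys ≡ zs

Eval-deterministic ev-zero ev-zero = refl
Eval-deterministic ev-succ ev-succ = refl
Eval-deterministic ev-proj ev-proj = refl
Eval-deterministic (ev-comp ps p) (ev-comp qs q) with refl ← EvalAll-deterministic ps qs =
  Eval-deterministic p q
Eval-deterministic (ev-rec0 p) (ev-rec0 q) = Eval-deterministic p q
Eval-deterministic (ev-recS p p′) (ev-recS q q′) with refl ← Eval-deterministic p q =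
  Eval-deterministic p′ q′
Eval-deterministic (ev-min {y = y} p below) (ev-min {y = z} q below′) with <-cmp y z
... | tri≈ _ y≡z _ = y≡z
... | tri< y<z _ _ with () ← Eval-deterministic p (proj₂ (below′ y y<z))
... | tri> _ _ z<y with v , r ← below z z<y with () ← Eval-deterministic r q

EvalAll-deterministic [] [] = refl
EvalAll-deterministic (p ∷ ps) (q ∷ qs) =
  cong₂ _∷_ (Eval-deterministic p q) (EvalAll-deterministic ps qs)

-- Finite sums

∑ : ℕ → (ℕ → ℕ) → ℕ
∑ zero    f = 0
∑ (suc n) f = ∑ n f + f n

∑-mono-≤ : ∀ n {f g : ℕ → ℕ} → (∀ i → i < n → f i ≤ g i) → ∑ n f ≤ ∑ n g
∑-mono-≤ zero    f≤g = z≤n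
∑-mono-≤ (suc n) f≤g =
  +-mono-≤ (∑-mono-≤ n λ i i<n → f≤g i (m<n⇒m<1+n i<n)) (f≤g n ≤-refl)

∑-const : ∀ n b → ∑ n (λ _ → b) ≡ n * b
∑-const zero    b = refl
∑-const (suc n) b = trans (cong (_+ b) (∑-const n b)) (+-comm (n * b) b)

∑-cong : ∀ n {f g : ℕ → ℕ} → (∀ i → i < n → f i ≡ g i) → ∑ n f ≡ ∑ n g
∑-cong n f≡g = ≤-antisym (∑-mono-≤ n λ i i<n → ≤-reflexive (f≡g i i<n))
                         (∑-mono-≤ n λ i i<n → ≤-reflexive (sym (f≡g i i<n)))

∑≡0⇒≡0 : ∀ n {f : ℕ → ℕ} → ∑ n f ≡ 0 → ∀ i → i < n → f i ≡ 0
∑≡0⇒≡0 (suc n) {f} sum≡0 i i<1+n with m≤n⇒m<n∨m≡n i<1+n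
... | inj₁ (s≤s i<n) = ∑≡0⇒≡0 n (m+n≡0⇒m≡0 (∑ n f) sum≡0) i i<n
... | inj₂ refl      = m+n≡0⇒n≡0 (∑ n f) sum≡0

≡0⇒∑≡0 : ∀ n {f : ℕ → ℕ} → (∀ i → i < n → f i ≡ 0) → ∑ n f ≡ 0
≡0⇒∑≡0 n f≡0 = trans (∑-cong n f≡0) (trans (∑-const n 0) (*-zeroʳ n))

∑≢0⇒∃≢0 : ∀ n {f : ℕ → ℕ} → ∑ n f ≢ 0 → ∃ λ i → i < n × f i ≢ 0
∑≢0⇒∃≢0 zero        sum≢0 = contradiction refl sum≢0
∑≢0⇒∃≢0 (suc n) {f} sum≢0 with f n ≟ 0
... | no fn≢0  = n , ≤-refl , fn≢0
... | yes fn≡0 with i , i<n , fi≢0 ← ∑≢0⇒∃≢0 n (λ eq → sum≢0 (cong₂ _+_ eq fn≡0)) =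
  i , m<n⇒m<1+n i<n , fi≢0

∑-split : ∀ m n (f : ℕ → ℕ) → ∑ (m + n) f ≡ ∑ m f + ∑ n (λ i → f (m + i))
∑-split m zero    f = trans (cong (λ l → ∑ l f) (+-identityʳ m)) (sym (+-identityʳ (∑ m f)))
∑-split m (suc n) f = begin
  ∑ (m + suc n) f                                  ≡⟨ cong (λ l → ∑ l f) (+-suc m n) ⟩
  ∑ (m + n) f + f (m + n)                          ≡⟨ cong (_+ f (m + n)) (∑-split m n f) ⟩
  ∑ m f + ∑ n (λ i → f (m + i)) + f (m + n)        ≡⟨ +-assoc (∑ m f) _ _ ⟩
  ∑ m f + (∑ n (λ i → f (m + i)) + f (m + n))      ∎
  where open ≡-Reasoning

*-distribˡ-∑ : ∀ q n (f : ℕ → ℕ) → q * ∑ n f ≡ ∑ n (λ i → q * f i)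
*-distribˡ-∑ q zero    f = *-zeroʳ q
*-distribˡ-∑ q (suc n) f = trans (*-distribˡ-+ q (∑ n f) (f n)) (cong (_+ q * f n) (*-distribˡ-∑ q n f))

∑-suc : ∀ n (f : ℕ → ℕ) → n + ∑ n f ≡ ∑ n (suc ∘ f)
∑-suc zero    f = refl
∑-suc (suc n) f = trans (cong suc (sym (+-assoc n (∑ n f) (f n))))
  (trans (sym (+-suc (n + ∑ n f) (f n))) (cong (_+ suc (f n)) (∑-suc n f)))

∑-head : ∀ n (f : ℕ → ℕ) → ∑ (suc n) f ≡ f 0 + ∑ n (f ∘ suc)
∑-head = ∑-split 1

∑-mono-bound : ∀ {m n} (f : ℕ → ℕ) → m ≤ n → ∑ m f ≤ ∑ n f
∑-mono-bound {m} f m≤n with k , refl ← m≤n⇒∃[o]m+o≡n m≤n =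
  ≤-trans (m≤m+n (∑ m f) _) (≤-reflexive (sym (∑-split m k f)))

∑-remove : ∀ n x (χ : ℕ → ℕ) → x < n →
  ∃ λ χ′ → ∑ n χ′ + χ x ≡ ∑ n χ × (∀ i → i ≢ x → χ′ i ≡ χ i)
∑-remove (suc n) x χ x<1+n = χ′ , sum-χ′ (suc n) x<1+n , off
  where
  χ′ : ℕ → ℕ
  χ′ i with i ≟ x
  ... | yes _ = 0
  ... | no  _ = χ i

  at-x : χ′ x ≡ 0
  at-x with x ≟ x
  ... | yes _  = refl
  ... | no x≢x = contradiction refl x≢x

  off : ∀ i → i ≢ x → χ′ i ≡ χ i
  off i i≢x with i ≟ x
  ... | yes i≡x = contradiction i≡x i≢x
  ... | no  _   = refl

  sum-χ′ : ∀ m → x < m → ∑ m χ′ + χ x ≡ ∑ m χ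
  sum-χ′ (suc m) x<1+m with m≤n⇒m<n∨m≡n x<1+m
  ... | inj₂ refl = cong (_+ χ x) (trans (cong₂ _+_ (∑-cong m λ i i<m → off i (<⇒≢ i<m)) at-x)
                                         (+-identityʳ _))
  ... | inj₁ (s≤s x<m) = begin
    ∑ m χ′ + χ′ m + χ x    ≡⟨ cong (λ z → ∑ m χ′ + z + χ x) (off m (>⇒≢ x<m)) ⟩
    ∑ m χ′ + χ m + χ x     ≡⟨ solve 3 (λ a b c → a :+ b :+ c := a :+ c :+ b) refl (∑ m χ′) (χ m) (χ x) ⟩
    ∑ m χ′ + χ x + χ m     ≡⟨ cong (_+ χ m) (sum-χ′ m x<m) ⟩
    ∑ m χ + χ m            ∎
    where open ≡-Reasoning
          open +-*-Solver

-- Pigeonhole by deletion: zeroing the weight at `h zero` lowers the sum by at least 1, and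
-- injectivity leaves the weights at the other values of `h` untouched.
injection⇒≤∑ : ∀ m n (χ : ℕ → ℕ) (h : Fin m → ℕ) → (∀ i j → h i ≡ h j → i ≡ j) →
  (∀ i → h i < n) → (∀ i → 1 ≤ χ (h i)) → m ≤ ∑ n χ
injection⇒≤∑ zero    n χ h inj h<n χh = z≤n
injection⇒≤∑ (suc m) n χ h inj h<n χh with ∑-remove n (h zero) χ (h<n zero)
... | χ′ , sum≡ , off = begin
  suc m                  ≡⟨ +-comm 1 m ⟩
  m + 1                  ≤⟨ +-mono-≤ (injection⇒≤∑ m n χ′ (h ∘ suc) inj′ (h<n ∘ suc) χ′h) (χh zero) ⟩
  ∑ n χ′ + χ (h zero)    ≡⟨ sum≡ ⟩
  ∑ n χ                  ∎
  where
  open ≤-Reasoning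
  inj′ : ∀ i j → h (suc i) ≡ h (suc j) → i ≡ j
  inj′ i j eq with refl ← inj (suc i) (suc j) eq = refl
  χ′h : ∀ i → 1 ≤ χ′ (h (suc i))
  χ′h i = subst (1 ≤_) (sym (off _ λ eq → suc≢zero (inj (suc i) zero eq))) (χh (suc i))
    where
    suc≢zero : Fin.suc i ≢ zero
    suc≢zero ()

-- Set families, the Sauer-Shelah lemma and hitting sets

⟦_⟧ : Bool → ℕ
⟦ false ⟧ = 0
⟦ true  ⟧ = 1

-- A vector of length n stands for a subset of {0, …, n - 1}, so positions from n on are not members.
mem : ∀ {n} → Vec Bool n → ℕ → Bool
mem []      i       = false
mem (b ∷ D) zero    = b
mem (b ∷ D) (suc i) = mem D i

size : ∀ {n} → Vec Bool n → ℕ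
size {n} D = ∑ n (λ i → ⟦ mem D i ⟧)

wsum : ∀ {n} → (Vec Bool n → ℕ) → ℕ
wsum {zero}  w = w []
wsum {suc n} w = wsum (λ D → w (false ∷ D)) + wsum (λ D → w (true ∷ D))

wsum-mono-≤ : ∀ {n} {v w : Vec Bool n → ℕ} → (∀ D → v D ≤ w D) → wsum v ≤ wsum w
wsum-mono-≤ {zero}  v≤w = v≤w []
wsum-mono-≤ {suc n} v≤w = +-mono-≤ (wsum-mono-≤ λ D → v≤w (false ∷ D)) (wsum-mono-≤ λ D → v≤w (true ∷ D))

wsum-cong : ∀ {n} {v w : Vec Bool n → ℕ} → (∀ D → v D ≡ w D) → wsum v ≡ wsum w
wsum-cong v≡w = ≤-antisym (wsum-mono-≤ (≤-reflexive ∘ v≡w)) (wsum-mono-≤ (≤-reflexive ∘ sym ∘ v≡w))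

wsum-+ : ∀ {n} (v w : Vec Bool n → ℕ) → wsum (λ D → v D + w D) ≡ wsum v + wsum w
wsum-+ {zero}  v w = refl
wsum-+ {suc n} v w = trans (cong₂ _+_ (wsum-+ (λ D → v (false ∷ D)) _) (wsum-+ (λ D → v (true ∷ D)) _))
  (solve 4 (λ a b c d → (a :+ b) :+ (c :+ d) := (a :+ c) :+ (b :+ d)) refl
     (wsum λ D → v (false ∷ D)) (wsum λ D → w (false ∷ D)) (wsum λ D → v (true ∷ D)) (wsum λ D → w (true ∷ D)))
  where open +-*-Solver

wsum-* : ∀ {n} a (w : Vec Bool n → ℕ) → wsum (λ D → a * w D) ≡ a * wsum w
wsum-* {zero}  a w = refl
wsum-* {suc n} a w = trans (cong₂ _+_ (wsum-* a λ D → w (false ∷ D)) (wsum-* a λ D → w (true ∷ D)))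
                           (sym (*-distribˡ-+ a _ _))

wsum-∑ : ∀ {n} m (w : ℕ → Vec Bool n → ℕ) → ∑ m (λ i → wsum (w i)) ≡ wsum (λ D → ∑ m (λ i → w i D))
wsum-∑ {n} zero w = sym (wsum-* 0 λ (_ : Vec Bool n) → 0)
wsum-∑ (suc m) w = trans (cong (_+ wsum (w m)) (wsum-∑ m w)) (sym (wsum-+ (λ D → ∑ m λ i → w i D) (w m)))

Family : ℕ → Set
Family n = Vec Bool n → Bool

card : ∀ {n} → Family n → ℕ
card F = wsum (λ D → ⟦ F D ⟧)

-- VC dimension below k, phrased with tuples because the predictor takes tuples. A tuple with a
-- repeated entry misses every pattern that differs at the two copies, so only sets of k distinct
-- points matter.
NoShatter : ∀ {n} → ℕ → Family n → Set
NoShatter {n} k F = ∀ (T : Vec (Fin n) k) → ∃ λ p → ∀ D → F D ≡ true → map (mem D ∘ toℕ) T ≢ p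

card-∨-∧ : ∀ {n} (F G : Family n) → card F + card G ≡ card (λ D → F D ∨ G D) + card (λ D → F D ∧ G D)
card-∨-∧ F G = trans (sym (wsum-+ (λ D → ⟦ F D ⟧) _))
  (trans (wsum-cong λ D → pointwise (F D) (G D)) (wsum-+ (λ D → ⟦ F D ∨ G D ⟧) _))
  where
  pointwise : ∀ a b → ⟦ a ⟧ + ⟦ b ⟧ ≡ ⟦ a ∨ b ⟧ + ⟦ a ∧ b ⟧
  pointwise false b     = sym (+-identityʳ ⟦ b ⟧)
  pointwise true  false = refl
  pointwise true  true  = refl

∧-true : ∀ a b → a ∧ b ≡ true → a ≡ true × b ≡ true
∧-true true true refl = refl , refl

-- Splitting on the first point gives two families with the same total count as their union and
-- intersection. A tuple shattered by the intersection would stay shattered with the first point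
-- added, so there k drops by one. The bound is crude, but only its logarithm matters for the
-- hitting set.
sauer-shelah : ∀ {n} k (F : Family n) → NoShatter k F → card F ≤ suc n ^ k
sauer-shelah {n} zero F ns = ≤-trans
  (≤-reflexive (trans (wsum-cong empty) (wsum-* 0 λ (_ : Vec Bool n) → 0))) z≤n
  where
  empty : ∀ D → ⟦ F D ⟧ ≡ 0
  empty D with F D in eq | ns []
  ... | false | _           = refl
  ... | true  | [] , p-miss = contradiction refl (p-miss D eq)
sauer-shelah {zero} (suc k) F ns = ≤-trans (≤1 (F [])) (≤-reflexive (sym (^-zeroˡ (suc k))))
  where
  ≤1 : ∀ b → ⟦ b ⟧ ≤ 1
  ≤1 false = z≤n
  ≤1 true  = ≤-refl
sauer-shelah {suc n} (suc k) F ns = begin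
  card F₀ + card F₁                                      ≡⟨ card-∨-∧ F₀ F₁ ⟩
  card (λ D → F₀ D ∨ F₁ D) + card (λ D → F₀ D ∧ F₁ D)    ≤⟨ +-mono-≤ (sauer-shelah (suc k) _ ns∨) (sauer-shelah k _ ns∧) ⟩
  suc n ^ suc k + suc n ^ k                              ≡⟨ +-comm (suc n ^ suc k) _ ⟩
  suc (suc n) * suc n ^ k                                ≤⟨ *-monoʳ-≤ (suc (suc n)) (^-monoˡ-≤ k (n≤1+n (suc n))) ⟩
  suc (suc n) ^ suc k                                    ∎
  where
  open ≤-Reasoning
  F₀ F₁ : Family n
  F₀ D = F (false ∷ D)
  F₁ D = F (true ∷ D)

  restrict : ∀ {j} b (D : Vec Bool n) (T : Vec (Fin n) j) →
    map (mem (b ∷ D) ∘ toℕ) (map suc T) ≡ map (mem D ∘ toℕ) T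
  restrict b D T = sym (map-∘ _ suc T)

  ns∨ : NoShatter (suc k) (λ D → F₀ D ∨ F₁ D)
  ns∨ T with ns (map suc T)
  ... | p , p-miss = p , miss
    where
    miss : ∀ D → F₀ D ∨ F₁ D ≡ true → map (mem D ∘ toℕ) T ≢ p
    miss D F∨ eq with F₀ D in F₀D
    ... | true  = p-miss (false ∷ D) F₀D (trans (restrict false D T) eq)
    ... | false = p-miss (true ∷ D) F∨ (trans (restrict true D T) eq)

  ns∧ : NoShatter k (λ D → F₀ D ∧ F₁ D)
  ns∧ T with ns (zero ∷ map suc T)
  ... | b ∷ p , p-miss = p , miss
    where
    both : ∀ b D → F₀ D ∧ F₁ D ≡ true → F (b ∷ D) ≡ true
    both false D = proj₁ ∘ ∧-true (F₀ D) (F₁ D)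
    both true  D = proj₂ ∘ ∧-true (F₀ D) (F₁ D)
    miss : ∀ D → F₀ D ∧ F₁ D ≡ true → map (mem D ∘ toℕ) T ≢ p
    miss D F∧ eq = p-miss (b ∷ D) (both b D F∧) (cong (b ∷_) (trans (restrict b D T) eq))

HitBy : ∀ {n} → ℕ → Family n → Set
HitBy {n} b F = ∃ λ (G : Vec Bool n) → size G ≤ b ×
  (∀ D → F D ≡ true → ∃ λ x → x < n × mem D x ≡ true × mem G x ≡ true)

size-∷ : ∀ {n} b (D : Vec Bool n) → size (b ∷ D) ≡ ⟦ b ⟧ + size D
size-∷ {n} b D = ∑-head n _

insert : ∀ {n} → ℕ → Vec Bool n → Vec Bool n
insert x       []      = []
insert zero    (b ∷ D) = true ∷ D
insert (suc x) (b ∷ D) = b ∷ insert x D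

size-insert : ∀ {n} x (D : Vec Bool n) → size (insert x D) ≤ suc (size D)
size-insert x       []      = z≤n
size-insert zero    (b ∷ D) = begin
  size (true ∷ D)          ≡⟨ size-∷ true D ⟩
  suc (size D)             ≤⟨ s≤s (m≤n+m (size D) ⟦ b ⟧) ⟩
  suc (⟦ b ⟧ + size D)     ≡⟨ cong suc (size-∷ b D) ⟨
  suc (size (b ∷ D))       ∎
  where open ≤-Reasoning
size-insert (suc x) (b ∷ D) = begin
  size (b ∷ insert x D)        ≡⟨ size-∷ b (insert x D) ⟩
  ⟦ b ⟧ + size (insert x D)    ≤⟨ +-monoʳ-≤ ⟦ b ⟧ (size-insert x D) ⟩
  ⟦ b ⟧ + suc (size D)         ≡⟨ +-suc ⟦ b ⟧ (size D) ⟩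
  suc (⟦ b ⟧ + size D)         ≡⟨ cong suc (size-∷ b D) ⟨
  suc (size (b ∷ D))           ∎
  where open ≤-Reasoning

mem-insert : ∀ {n} x (D : Vec Bool n) → x < n → mem (insert x D) x ≡ true
mem-insert zero    (b ∷ D) x<n       = refl
mem-insert (suc x) (b ∷ D) (s≤s x<n) = mem-insert x D x<n

mem⇒mem-insert : ∀ {n} x (D : Vec Bool n) y → mem D y ≡ true → mem (insert x D) y ≡ true
mem⇒mem-insert zero    (b ∷ D) zero    eq = refl
mem⇒mem-insert zero    (b ∷ D) (suc y) eq = eq
mem⇒mem-insert (suc x) (b ∷ D) zero    eq = eq
mem⇒mem-insert (suc x) (b ∷ D) (suc y) eq = mem⇒mem-insert x D y eq

_containing_ _avoiding_ : ∀ {n} → Family n → ℕ → Family n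
(F containing x) D = F D ∧ mem D x
(F avoiding x)   D = F D ∧ not (mem D x)

card-containing-avoiding : ∀ {n} (F : Family n) x → card (F containing x) + card (F avoiding x) ≡ card F
card-containing-avoiding F x = trans (sym (wsum-+ (λ D → ⟦ F D ∧ mem D x ⟧) _)) (wsum-cong λ D → pointwise (F D) (mem D x))
  where
  pointwise : ∀ a b → ⟦ a ∧ b ⟧ + ⟦ a ∧ not b ⟧ ≡ ⟦ a ⟧
  pointwise false b     = refl
  pointwise true  false = refl
  pointwise true  true  = refl

hitBy-suc : ∀ {n b x} (F : Family n) → x < n → HitBy b (F avoiding x) → HitBy (suc b) F
hitBy-suc {n} {b} {x} F x<n (G , size-G , hit) = insert x G , ≤-trans (size-insert x G) (s≤s size-G) , hit′
  where
  hit′ : ∀ D → F D ≡ true → ∃ λ y → y < n × mem D y ≡ true × mem (insert x G) y ≡ true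
  hit′ D FD with mem D x in x∈D | hit D
  ... | true  | _    = x , x<n , x∈D , mem-insert x G x<n
  ... | false | hitD with y , y<n , y∈D , y∈G ← hitD (cong (_∧ true) FD) =
    y , y<n , y∈D , mem⇒mem-insert x G y y∈G

hitBy-mono : ∀ {n b c} {F : Family n} → b ≤ c → HitBy b F → HitBy c F
hitBy-mono b≤c (G , size-G , hit) = G , ≤-trans size-G b≤c , hit

module _ {n : ℕ} (q a : ℕ) (0<n : 0 < n) (n≤qa : n ≤ q * a) where

  Large : Family n → Set
  Large F = ∀ D → F D ≡ true → a ≤ size D

  large-avoiding : ∀ {F} x → Large F → Large (F avoiding x)
  large-avoiding {F} x large D eq = large D (proj₁ (∧-true (F D) _ eq))

  double-counting : ∀ {F} → Large F → a * card F ≤ ∑ n (λ x → card (F containing x))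
  double-counting {F} large = begin
    a * card F                                        ≡⟨ wsum-* a (λ D → ⟦ F D ⟧) ⟨
    wsum (λ D → a * ⟦ F D ⟧)                          ≤⟨ wsum-mono-≤ pointwise ⟩
    wsum (λ D → ∑ n (λ x → ⟦ (F containing x) D ⟧))   ≡⟨ wsum-∑ n (λ x D → ⟦ (F containing x) D ⟧) ⟨
    ∑ n (λ x → card (F containing x))                 ∎
    where
    open ≤-Reasoning
    pointwise : ∀ D → a * ⟦ F D ⟧ ≤ ∑ n (λ x → ⟦ F D ∧ mem D x ⟧)
    pointwise D with F D in FD
    ... | true  = subst (_≤ size D) (sym (*-identityʳ a)) (large D FD)
    ... | false = ≤-trans (≤-reflexive (*-zeroʳ a)) z≤n

  -- Averaging: each member fills at least a fraction 1/q of the n points, so some point lies in at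
  -- least a fraction 1/q of the members. If every point fell short, summing the strict inequalities
  -- over the n > 0 points would contradict double counting.
  popular-element : ∀ {F} → Large F → ∃ λ x → x < n × card F ≤ q * card (F containing x)
  popular-element {F} large with anyUpTo? (λ x → card F ≤? q * card (F containing x)) n
  ... | yes found = found
  ... | no none   = contradiction bound (<⇒≱ below)
    where
    open ≤-Reasoning
    rare : ∀ x → x < n → suc (q * card (F containing x)) ≤ card F
    rare x x<n = ≰⇒> λ le → none (x , x<n , le)
    bound : n * card F ≤ q * ∑ n (λ x → card (F containing x))
    bound = begin
      n * card F          ≤⟨ *-monoˡ-≤ (card F) n≤qa ⟩
      q * a * card F      ≡⟨ *-assoc q a (card F) ⟩
      q * (a * card F)    ≤⟨ *-monoʳ-≤ q (double-counting large) ⟩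
      q * ∑ n (λ x → card (F containing x)) ∎
    below : q * ∑ n (λ x → card (F containing x)) < n * card F
    below = begin-strict
      q * ∑ n (λ x → card (F containing x))             ≡⟨ *-distribˡ-∑ q n _ ⟩
      ∑ n (λ x → q * card (F containing x))             <⟨ +-monoˡ-≤ _ 0<n ⟩
      n + ∑ n (λ x → q * card (F containing x))         ≡⟨ ∑-suc n _ ⟩
      ∑ n (λ x → suc (q * card (F containing x)))       ≤⟨ ∑-mono-≤ n rare ⟩
      ∑ n (λ _ → card F)                                ≡⟨ ∑-const n (card F) ⟩
      n * card F                                        ∎

  -- As long as more than half of the original C sets are left, a popular element hits at
  -- least C / 2q of them, so q greedy steps halve the family.
  halve : ∀ {b C} → (∀ F → Large F → 2 * card F ≤ C → HitBy b F) →
    ∀ j F → Large F → 2 * (q * card F) ≤ q * C + j * C → HitBy (j + b) F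
  halve {b} {C} finish j F large bound with 2 * card F ≤? C
  halve {b} finish j F large bound | yes few = hitBy-mono (m≤n+m b j) (finish F large few)
  halve {b} {C} finish zero F large bound | no many = contradiction (*-cancelˡ-≤ q (begin
      q * (2 * card F)     ≡⟨ solve 2 (λ q c → q :* (con 2 :* c) := con 2 :* (q :* c)) refl q (card F) ⟩
      2 * (q * card F)     ≤⟨ bound ⟩
      q * C + 0            ≡⟨ +-identityʳ _ ⟩
      q * C                ∎)) many
    where
    open ≤-Reasoning
    open +-*-Solver
    instance
      q-nonZero : NonZero q
      q-nonZero = ≢-nonZero λ q≡0 → <⇒≱ 0<n (subst (λ r → n ≤ r * a) q≡0 n≤qa)
  halve {b} {C} finish (suc j) F large bound | no many with popular-element large
  ... | x , x<n , popular = hitBy-suc F x<n (halve finish j (F avoiding x) (large-avoiding x large)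
    (+-cancelʳ-≤ C _ _ (begin
      2 * (q * A) + C                             ≤⟨ +-monoʳ-≤ (2 * (q * A)) (≤-trans (<⇒≤ (≰⇒> many)) (*-monoʳ-≤ 2 popular)) ⟩
      2 * (q * A) + 2 * (q * P)                   ≡⟨ solve 3 (λ q u v →
        con 2 :* (q :* u) :+ con 2 :* (q :* v) := con 2 :* (q :* (v :+ u))) refl q A P ⟩
      2 * (q * (P + A))                           ≡⟨ cong (λ z → 2 * (q * z)) (card-containing-avoiding F x) ⟩
      2 * (q * card F)                            ≤⟨ bound ⟩
      q * C + (C + j * C)                         ≡⟨ solve 3 (λ u c v → u :+ (c :+ v) := u :+ v :+ c) refl (q * C) C (j * C) ⟩
      q * C + j * C + C                           ∎)))
    where
    open ≤-Reasoning
    open +-*-Solver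
    A = card (F avoiding x)
    P = card (F containing x)

  card≡0⇒hitBy : ∀ F → card F ≡ 0 → HitBy 0 F
  card≡0⇒hitBy F empty = ∅ n , ≤-reflexive (size-∅ n) , λ D FD → contradiction (trans (sym FD) (none F empty D)) λ ()
    where
    ∅ : ∀ m → Vec Bool m
    ∅ zero    = []
    ∅ (suc m) = false ∷ ∅ m
    size-∅ : ∀ m → size (∅ m) ≡ 0
    size-∅ zero    = refl
    size-∅ (suc m) = trans (size-∷ false (∅ m)) (size-∅ m)
    none : ∀ {m} (F : Family m) → card F ≡ 0 → ∀ D → F D ≡ false
    none F eq [] with false ← F [] = refl
    none F eq (false ∷ D) = none _ (m+n≡0⇒m≡0 _ eq) D
    none F eq (true ∷ D)  = none _ (m+n≡0⇒n≡0 (card λ D → F (false ∷ D)) eq) D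

  -- Each halving costs q elements, and after t halvings less than one member is left.
  small-hitting-set : ∀ t F → Large F → card F < 2 ^ t → HitBy (t * q) F
  small-hitting-set zero    F large (s≤s le) = card≡0⇒hitBy F (n≤0⇒n≡0 le)
  small-hitting-set (suc t) F large card<   =
    halve (λ F′ large′ half → small-hitting-set t F′ large′ (*-cancelˡ-< 2 _ _ (≤-<-trans half card<)))
      q F large (≤-reflexive (cong (q * card F +_) (+-identityʳ (q * card F))))

-- Computable functions

record Computable {n} (f : Vec ℕ n → ℕ) : Set where
  constructor computable
  field
    program  : PR n
    computes : ∀ xs → Eval program xs (f xs)

open Computable

computable-cong : ∀ {n} {f g : Vec ℕ n → ℕ} → (∀ xs → f xs ≡ g xs) → Computable f → Computable g
computable-cong f≡g (computable t ev) = computable t λ xs → subst (Eval t xs) (f≡g xs) (ev xs)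

evalAll-tabulate : ∀ {n m xs} {ts : Fin m → PR n} {vs : Fin m → ℕ} →
  (∀ i → Eval (ts i) xs (vs i)) → EvalAll (tabulate ts) xs (tabulate vs)
evalAll-tabulate {m = zero}  ev = []
evalAll-tabulate {m = suc m} ev = ev zero ∷ evalAll-tabulate (ev ∘ suc)

compose : ∀ {n m} {h : Vec ℕ m → ℕ} {fs : Fin m → Vec ℕ n → ℕ} →
  Computable h → (∀ i → Computable (fs i)) → Computable (λ xs → h (tabulate λ i → fs i xs))
compose (computable t ev) cs = computable (compF t (tabulate (program ∘ cs)))
  λ xs → ev-comp (evalAll-tabulate λ i → computes (cs i) xs) (ev _)

Computable₁ : (ℕ → ℕ) → Set
Computable₁ h = Computable {1} (λ ys → h (lookup ys 0F))

Computable₂ : (ℕ → ℕ → ℕ) → Set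
Computable₂ h = Computable {2} (λ ys → h (lookup ys 0F) (lookup ys 1F))

compose₁ : ∀ {n} (h : ℕ → ℕ) {f : Vec ℕ n → ℕ} →
  Computable₁ h → Computable f → Computable (λ xs → h (f xs))
compose₁ h (computable t ev) (computable u ev′) =
  computable (compF t (u ∷ [])) λ xs → ev-comp (ev′ xs ∷ []) (ev _)

compose₂ : ∀ {n} (h : ℕ → ℕ → ℕ) {f g : Vec ℕ n → ℕ} →
  Computable₂ h → Computable f → Computable g → Computable (λ xs → h (f xs) (g xs))
compose₂ h (computable t ev) (computable u ev′) (computable v ev″) =
  computable (compF t (u ∷ v ∷ [])) λ xs → ev-comp (ev′ xs ∷ ev″ xs ∷ []) (ev _)

computable-lookup : ∀ {n} (i : Fin n) → Computable (λ xs → lookup xs i)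
computable-lookup i = computable (projF i) λ xs → ev-proj

computable-suc : Computable₁ suc
computable-suc = computable succF λ { (x ∷ []) → ev-succ }

computable-const : ∀ {n} c → Computable {n} (λ _ → c)
computable-const zero    = computable zeroF λ xs → ev-zero
computable-const (suc c) = compose₁ suc computable-suc (computable-const c)

primitive-recursion : ∀ {n} {b : Vec ℕ n → ℕ} {h : Vec ℕ (2 + n) → ℕ} (r : ℕ → Vec ℕ n → ℕ) →
  Computable b → Computable h →
  (∀ xs → b xs ≡ r 0 xs) → (∀ y xs → h (y ∷ r y xs ∷ xs) ≡ r (suc y) xs) →
  Computable (λ ys → r (head ys) (tail ys))
primitive-recursion r (computable t ev) (computable u ev′) base step =
  computable (recF t u) λ { (y ∷ xs) → rec y xs }
  where
  rec : ∀ y xs → Eval (recF t u) (y ∷ xs) (r y xs)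
  rec zero    xs = ev-rec0 (subst (Eval t xs) (base xs) (ev xs))
  rec (suc y) xs = ev-recS (rec y xs) (subst (Eval u _) (step y xs) (ev′ _))

primitive-recursion₁ : ∀ {b} {h : Vec ℕ 2 → ℕ} (r : ℕ → ℕ) → Computable h →
  b ≡ r 0 → (∀ y → h (y ∷ r y ∷ []) ≡ r (suc y)) → Computable₁ r
primitive-recursion₁ {b} r ch base step = computable-cong (λ { (y ∷ []) → refl })
  (primitive-recursion (λ y _ → r y) (computable-const b) ch (λ _ → base) λ { y [] → step y })

primitive-recursion₂ : ∀ {b : Vec ℕ 1 → ℕ} {h : Vec ℕ 3 → ℕ} (r : ℕ → ℕ → ℕ) →
  Computable b → Computable h →
  (∀ x → b (x ∷ []) ≡ r 0 x) → (∀ y x → h (y ∷ r y x ∷ x ∷ []) ≡ r (suc y) x) → Computable₂ r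
primitive-recursion₂ r cb ch base step = computable-cong (λ { (y ∷ x ∷ []) → refl })
  (primitive-recursion (λ y xs → r y (head xs)) cb ch (λ { (x ∷ []) → base x }) λ { y (x ∷ []) → step y x })

computable-drop : ∀ {n} m {f : Vec ℕ n → ℕ} → Computable f →
  Computable {m + n} (λ xs → f (tabulate λ i → lookup xs (m ↑ʳ i)))
computable-drop m c = compose c λ i → computable-lookup (m ↑ʳ i)

computable-+ : Computable₂ _+_
computable-+ = primitive-recursion₂ _+_ (computable-lookup 0F)
  (compose₁ suc computable-suc (computable-lookup 1F)) (λ _ → refl) (λ _ _ → refl)

computable-* : Computable₂ _*_
computable-* = primitive-recursion₂ _*_ (computable-const 0)
  (compose₂ _+_ computable-+ (computable-lookup 2F) (computable-lookup 1F)) (λ _ → refl) (λ _ _ → refl)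

computable-pred : Computable₁ pred
computable-pred = primitive-recursion₁ pred (computable-lookup 0F) refl (λ _ → refl)

computable-∸ : Computable₂ _∸_
computable-∸ = compose₂ (λ y x → x ∸ y) (primitive-recursion₂ (λ y x → x ∸ y)
    (computable-lookup 0F) (compose₁ pred computable-pred (computable-lookup 1F))
    (λ _ → refl) (λ y x → pred[m∸n]≡m∸[1+n] x y))
  (computable-lookup 1F) (computable-lookup 0F)

computable-2^ : Computable₁ (2 ^_)
computable-2^ = primitive-recursion₁ (2 ^_)
  (compose₂ _*_ computable-* (computable-const 2) (computable-lookup 1F)) refl (λ _ → refl)

computable-∑ : ∀ {n} {b : Vec ℕ n → ℕ} {f : Vec ℕ (suc n) → ℕ} → Computable b → Computable f →
  Computable (λ xs → ∑ (b xs) (λ i → f (i ∷ xs)))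
computable-∑ {n} {b} {f} cb cf = computable-cong eq (compose sum cs)
  where
  -- The recursion passes counter, accumulated sum and parameters; the summand must not see the
  -- accumulated sum, so position 1 is skipped.
  step-args : Fin (suc n) → Vec ℕ (2 + n) → ℕ
  step-args zero    ys = lookup ys 0F
  step-args (suc i) ys = lookup ys (suc (suc i))
  step-cs : ∀ i → Computable (step-args i)
  step-cs zero    = computable-lookup 0F
  step-cs (suc i) = computable-lookup (suc (suc i))
  sum : Computable (λ ys → ∑ (head ys) (λ i → f (i ∷ tail ys)))
  sum = primitive-recursion (λ y xs → ∑ y (λ i → f (i ∷ xs)))
    (computable-const 0)
    (compose₂ _+_ computable-+ (computable-lookup 1F) (compose cf step-cs))
    (λ _ → refl)
    (λ y xs → cong (λ zs → ∑ y (λ i → f (i ∷ xs)) + f (y ∷ zs)) (tabulate∘lookup xs))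
  args : Fin (suc n) → Vec ℕ n → ℕ
  args zero    xs = b xs
  args (suc i) xs = lookup xs i
  cs : ∀ i → Computable (args i)
  cs zero    = cb
  cs (suc i) = computable-lookup i
  eq : ∀ xs → ∑ (b xs) (λ i → f (i ∷ tabulate (lookup xs))) ≡ ∑ (b xs) (λ i → f (i ∷ xs))
  eq xs = cong (λ zs → ∑ (b xs) (λ i → f (i ∷ zs))) (tabulate∘lookup xs)

-- Bounded quantifiers as sums and products

∏ : ∀ {k} → (Fin k → ℕ) → ℕ
∏ {zero}  f = 1
∏ {suc k} f = f zero * ∏ (f ∘ suc)

-- With distances as factors, this turns agreement in at least one position into a single equation.
-- Sums play the dual role of universal quantifiers.
∏≡0⇒∃≡0 : ∀ {k} (f : Fin k → ℕ) → ∏ f ≡ 0 → ∃ λ i → f i ≡ 0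
∏≡0⇒∃≡0 {suc k} f eq with m*n≡0⇒m≡0∨n≡0 (f zero) eq
... | inj₁ f0≡0 = zero , f0≡0
... | inj₂ rest with i , fi≡0 ← ∏≡0⇒∃≡0 (f ∘ suc) rest = suc i , fi≡0

≡0⇒∏≡0 : ∀ {k} (f : Fin k → ℕ) i → f i ≡ 0 → ∏ f ≡ 0
≡0⇒∏≡0 f zero    eq = cong (_* ∏ (f ∘ suc)) eq
≡0⇒∏≡0 f (suc i) eq = trans (cong (f zero *_) (≡0⇒∏≡0 (f ∘ suc) i eq)) (*-zeroʳ (f zero))

computable-∏ : ∀ {n k} {f : Fin k → Vec ℕ n → ℕ} → (∀ i → Computable (f i)) →
  Computable (λ xs → ∏ (λ i → f i xs))
computable-∏ {k = zero}  cs = computable-const 1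
computable-∏ {k = suc k} cs = compose₂ _*_ computable-* (cs zero) (computable-∏ (cs ∘ suc))

-- Sums f (xs ++ ys) over all k-tuples xs with entries below b ys.
∑-tuples : ∀ {n} k → (Vec ℕ n → ℕ) → (Vec ℕ (k + n) → ℕ) → Vec ℕ n → ℕ
∑-tuples zero    b f = f
∑-tuples (suc k) b f =
  ∑-tuples k b λ zs → ∑ (b (tabulate λ i → lookup zs (k ↑ʳ i))) (λ x → f (x ∷ zs))

computable-∑-tuples : ∀ {n} k {b : Vec ℕ n → ℕ} {f : Vec ℕ (k + n) → ℕ} →
  Computable b → Computable f → Computable (∑-tuples k b f)
computable-∑-tuples zero    cb cf = cf
computable-∑-tuples (suc k) cb cf = computable-∑-tuples k cb (computable-∑ (computable-drop k cb) cf)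

tabulate-++ʳ : ∀ {n k} (xs : Vec ℕ k) (ys : Vec ℕ n) → tabulate (λ i → lookup (xs ++ ys) (k ↑ʳ i)) ≡ ys
tabulate-++ʳ xs ys = trans (tabulate-cong (lookup-++ʳ xs ys)) (tabulate∘lookup ys)

∑-tuples≡0⇒≡0 : ∀ {n} k {b : Vec ℕ n → ℕ} {f : Vec ℕ (k + n) → ℕ} {ys} → ∑-tuples k b f ys ≡ 0 →
  ∀ xs → All (_< b ys) xs → f (xs ++ ys) ≡ 0
∑-tuples≡0⇒≡0 zero    sum≡0 [] [] = sum≡0
∑-tuples≡0⇒≡0 (suc k) {b} {ys = ys} sum≡0 (x ∷ xs) (x< ∷ xs<) =
  ∑≡0⇒≡0 _ (∑-tuples≡0⇒≡0 k sum≡0 xs xs<) x (subst (λ zs → x < b zs) (sym (tabulate-++ʳ xs ys)) x<)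

≡0⇒∑-tuples≡0 : ∀ {n} k {b : Vec ℕ n → ℕ} {f : Vec ℕ (k + n) → ℕ} {ys} →
  (∀ xs → All (_< b ys) xs → f (xs ++ ys) ≡ 0) → ∑-tuples k b f ys ≡ 0
≡0⇒∑-tuples≡0 zero    f≡0 = f≡0 [] []
≡0⇒∑-tuples≡0 (suc k) {b} {ys = ys} f≡0 = ≡0⇒∑-tuples≡0 k λ xs xs< → ≡0⇒∑≡0 _ λ x x< →
  f≡0 (x ∷ xs) (subst (λ zs → x < b zs) (tabulate-++ʳ xs ys) x< ∷ xs<)

eval-minF : ∀ {n} {f : Vec ℕ (suc n) → ℕ} (c : Computable f) xs y → f (y ∷ xs) ≡ 0 →
  (∀ z → z < y → f (z ∷ xs) ≢ 0) → Eval (minF (program c)) xs y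
eval-minF {f = f} (computable t ev) xs y fy≡0 least = ev-min (subst (Eval t _) fy≡0 (ev _)) below
  where
  below : ∀ z → z < y → ∃ λ v → Eval t (z ∷ xs) (suc v)
  below z z<y with f (z ∷ xs) | ev (z ∷ xs) | least z z<y
  ... | zero  | _ | ≢0 = contradiction refl ≢0
  ... | suc v | e | _  = v , e

least-zero : ∀ (f : ℕ → ℕ) y → f y ≡ 0 → ∃ λ z → f z ≡ 0 × (∀ w → w < z → f w ≢ 0)
least-zero f zero    eq = 0 , eq , λ _ ()
least-zero f (suc y) eq with f 0 ≟ 0
... | yes f0≡0 = 0 , f0≡0 , λ _ ()
... | no  f0≢0 with z , fz≡0 , least ← least-zero (f ∘ suc) y eq =
  suc z , fz≡0 , λ { zero _ → f0≢0 ; (suc w) (s≤s w<z) → least w w<z }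

-- Binary codes of finite sets

lowBit half : ℕ → ℕ
lowBit zero    = 0
lowBit (suc x) = 1 ∸ lowBit x
half zero    = 0
-- Halving rounds down, so it grows exactly when x is odd. In this form it is a primitive recursion
-- as it stands.
half (suc x) = half x + lowBit x

shift : ℕ → ℕ → ℕ
shift zero    x = x
shift (suc i) x = half (shift i x)

bit : ℕ → ℕ → ℕ
bit i x = lowBit (shift i x)

computable-lowBit : Computable₁ lowBit
computable-lowBit = primitive-recursion₁ lowBit
  (compose₂ _∸_ computable-∸ (computable-const 1) (computable-lookup 1F)) refl (λ _ → refl)

computable-half : Computable₁ half
computable-half = primitive-recursion₁ half
  (compose₂ _+_ computable-+ (computable-lookup 1F) (compose₁ lowBit computable-lowBit (computable-lookup 0F)))
  refl (λ _ → refl)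

computable-bit : Computable₂ bit
computable-bit = compose₁ lowBit computable-lowBit (primitive-recursion₂ shift
  (computable-lookup 0F) (compose₁ half computable-half (computable-lookup 1F)) (λ _ → refl) (λ _ _ → refl))

encode : ∀ {n} → Vec Bool n → ℕ
encode []      = 0
encode (b ∷ D) = ⟦ b ⟧ + (encode D + encode D)

lowBit-double : ∀ x → lowBit (x + x) ≡ 0
lowBit-double zero    = refl
lowBit-double (suc x) rewrite +-suc x x | lowBit-double x = refl

half-double : ∀ x → half (x + x) ≡ x
half-double zero    = refl
half-double (suc x) rewrite +-suc x x | lowBit-double x | half-double x =
  trans (cong (_+ 1) (+-identityʳ x)) (+-comm x 1)

lowBit-cons : ∀ b x → lowBit (⟦ b ⟧ + (x + x)) ≡ ⟦ b ⟧
lowBit-cons false x = lowBit-double x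
lowBit-cons true  x rewrite lowBit-double x = refl

half-cons : ∀ b x → half (⟦ b ⟧ + (x + x)) ≡ x
half-cons false x = half-double x
half-cons true  x rewrite lowBit-double x | half-double x = +-identityʳ x

shift-half : ∀ i x → shift i (half x) ≡ half (shift i x)
shift-half zero    x = refl
shift-half (suc i) x = cong half (shift-half i x)

shift-0 : ∀ i → shift i 0 ≡ 0
shift-0 zero    = refl
shift-0 (suc i) rewrite shift-0 i = refl

bit-encode : ∀ {n} i (D : Vec Bool n) → bit i (encode D) ≡ ⟦ mem D i ⟧
bit-encode i       []      rewrite shift-0 i = refl
bit-encode zero    (b ∷ D) = lowBit-cons b (encode D)
bit-encode (suc i) (b ∷ D) = begin
  lowBit (half (shift i (encode (b ∷ D))))    ≡⟨ cong lowBit (shift-half i (encode (b ∷ D))) ⟨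
  bit i (half (encode (b ∷ D)))               ≡⟨ cong (bit i) (half-cons b (encode D)) ⟩
  bit i (encode D)                            ≡⟨ bit-encode i D ⟩
  ⟦ mem D i ⟧                                 ∎
  where open ≡-Reasoning

encode<2^n : ∀ {n} (D : Vec Bool n) → encode D < 2 ^ n
encode<2^n []              = ≤-refl
encode<2^n {suc n} (b ∷ D) = begin
  suc (⟦ b ⟧ + (encode D + encode D))     ≤⟨ s≤s (+-monoˡ-≤ _ (≤1 b)) ⟩
  suc (suc (encode D + encode D))         ≡⟨ cong suc (+-suc (encode D) (encode D)) ⟨
  suc (encode D) + suc (encode D)         ≤⟨ +-mono-≤ (encode<2^n D) (encode<2^n D) ⟩
  2 ^ n + 2 ^ n                           ≡⟨ cong (2 ^ n +_) (+-identityʳ (2 ^ n)) ⟨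
  2 ^ suc n                               ∎
  where
  open ≤-Reasoning
  ≤1 : ∀ b → ⟦ b ⟧ ≤ 1
  ≤1 false = z≤n
  ≤1 true  = ≤-refl

lowBit-half : ∀ x → ∃ λ b → x ≡ ⟦ b ⟧ + (half x + half x)
lowBit-half zero = false , refl
lowBit-half (suc x) with lowBit-half x
... | false , eq = true , cong suc (trans eq (cong (λ z → z + z) (sym (half-even))))
  where
  half-even : half x + lowBit x ≡ half x
  half-even = trans (cong (half x +_) (trans (cong lowBit eq) (lowBit-double (half x)))) (+-identityʳ _)
... | true  , eq = false , trans (cong suc eq)
  (trans (cong suc (sym (+-suc (half x) (half x)))) (cong (λ z → z + z) (sym half-odd)))
  where
  half-odd : half x + lowBit x ≡ suc (half x)
  half-odd = trans (cong (half x +_) (trans (cong lowBit eq) (lowBit-cons true (half x)))) (+-comm (half x) 1)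

halve-< : ∀ n b {x h} → x ≡ ⟦ b ⟧ + (h + h) → x < 2 ^ suc n → h < 2 ^ n
halve-< n b {x} {h} eq x< = *-cancelˡ-< 2 _ _ (begin-strict
  h + (h + 0)         ≡⟨ cong (h +_) (+-identityʳ h) ⟩
  h + h               ≤⟨ m≤n+m _ ⟦ b ⟧ ⟩
  ⟦ b ⟧ + (h + h)     ≡⟨ eq ⟨
  x                   <⟨ x< ⟩
  2 ^ suc n           ∎)
  where open ≤-Reasoning

-- The search tests all numbers below `2 ^ n`; the combinatorics applies to each of them only
-- because each is the code of a subset.
encode-surjective : ∀ n x → x < 2 ^ n → ∃ λ (D : Vec Bool n) → encode D ≡ x
encode-surjective zero    zero x< = [] , refl
encode-surjective zero    (suc x) (s≤s ())
encode-surjective (suc n) x    x< with b , eq ← lowBit-half x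
  with D , eq′ ← encode-surjective n (half x) (halve-< n b eq x<) =
  b ∷ D , trans (cong (λ z → ⟦ b ⟧ + (z + z)) eq′) (sym eq)

-- Minimal indices

-- Double negation commutes with finite conjunctions; this is how undecidable facts about all
-- positions of a window become available together.
¬¬-sequence : ∀ {n} {P : Fin n → Set} → (∀ i → ¬ ¬ P i) → ¬ ¬ (∀ i → P i)
¬¬-sequence = sequence (RawMonad.rawApplicative ¬¬-Monad)

SameFn-trans : ∀ {φ i ψ j χ l} → SameFn φ i ψ j → SameFn ψ j χ l → SameFn φ i χ l
SameFn-trans p q x y = proj₁ (q x y) ∘ proj₁ (p x y) , proj₂ (p x y) ∘ proj₂ (q x y)

-- The numbering `ψ` is legitimate for partial `t` too: where `t` diverges, the function of `ψ` is
-- nowhere defined. Where `t` yields y, `f e` is another index of the function with index y, so a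
-- minimal y cannot exceed it.
computed-minimal-index-bound : ∀ φ → Kolmogorov φ → (t : PR 1) →
  ∃ λ c → ∀ e y → Eval t (e ∷ []) y → MIN φ y → y ≤ c * e + c
computed-minimal-index-bound φ kolmogorov t = c , bound
  where
  ψ : Numbering
  ψ = compF φ (compF t (projF 0F ∷ []) ∷ projF 1F ∷ [])
  ψ-same : ∀ e y → Eval t (e ∷ []) y → SameFn ψ e φ y
  ψ-same e y ev x z = to , λ ev′ → ev-comp (ev-comp (ev-proj ∷ []) ev ∷ ev-proj ∷ []) ev′
    where
    to : ψ ⟨ e ⟩ x ⇓ z → φ ⟨ y ⟩ x ⇓ z
    to (ev-comp (ev-comp (ev-proj ∷ []) ev′ ∷ ev-proj ∷ []) ev″)
      with refl ← Eval-deterministic ev ev′ = ev″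
  c = proj₁ (kolmogorov ψ)
  f = proj₁ (proj₂ (kolmogorov ψ))
  f≤ : ∀ e → f e ≤ c * e + c
  f≤ = proj₁ (proj₂ (proj₂ (proj₂ (kolmogorov ψ))))
  same : ∀ e → SameFn φ (f e) ψ e
  same = proj₂ (proj₂ (proj₂ (proj₂ (kolmogorov ψ))))
  bound : ∀ e y → Eval t (e ∷ []) y → MIN φ y → y ≤ c * e + c
  bound e y ev min = ≤-trans (≮⇒≥ λ fe<y → min (f e) fe<y (SameFn-trans (same e) (ψ-same e y ev))) (f≤ e)

-- Equality of functions is undecidable, so the least index exists only classically: if there were
-- none, no smaller j could share the function of i, and i itself would be minimal.
minimal-index : ∀ φ i → ¬ ¬ (∃ λ j → j ≤ i × MIN φ j × SameFn φ j φ i)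
minimal-index φ = <-rec _ λ i rec none →
  none (i , ≤-refl , (λ j j<i same → rec j<i λ { (l , l≤j , min , same′) →
    none (l , ≤-trans l≤j (<⇒≤ j<i) , min , SameFn-trans same′ same) }) , λ x y → id , id)

-- The `2 * a` constant functions with values below `2 * a` have distinct minimal indices, none
-- above `2 * c * a`. At most a of these lie below a, so at least a lie in the window. Any `χ` that
-- is positive on the minimal offsets may be counted.
minimal-indices-dense : ∀ φ → Kolmogorov φ → ∃ λ c → 0 < c ×
  (∀ a (χ : ℕ → ℕ) → (∀ i → i < 2 * c * a → MIN φ (a + i) → 1 ≤ χ i) → a ≤ ∑ (2 * c * a) χ)
-- In the numbering `projF 0F` the index e denotes the constant function e.
minimal-indices-dense φ kolmogorov with kolmogorov (projF 0F)
... | c , f , 0<c , f≤ , same = c , 0<c , dense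
  where
  Index : ∀ {m} → Fin m → Set
  Index e = ∃ λ j → j ≤ f (toℕ e) × MIN φ j × SameFn φ j (projF 0F) (toℕ e)

  dense : ∀ a (χ : ℕ → ℕ) → (∀ i → i < 2 * c * a → MIN φ (a + i) → 1 ≤ χ i) → a ≤ ∑ (2 * c * a) χ
  -- An inequality of numbers is stable, so the classical choice of minimal indices may be used for
  -- it.
  dense a χ χ-min = decidable-stable (a ≤? _) λ a≰ →
    ¬¬-sequence (λ e none → minimal-index φ (f (toℕ e)) λ { (j , j≤ , min , same′) →
      none (j , j≤ , min , SameFn-trans same′ (same (toℕ e))) }) (a≰ ∘ count)
    where
    n = 2 * c * a
    χ′ : ℕ → ℕ
    -- Each number below a gets weight 1, so the minimal indices to the left of the window cost at
    -- most a in total.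
    χ′ i with i <? a
    ... | yes _ = 1
    ... | no  _ = χ (i ∸ a)

    count : ((e : Fin (a + a)) → Index e) → a ≤ ∑ n χ
    count index = +-cancelˡ-≤ a _ _ (begin
      a + a                               ≤⟨ injection⇒≤∑ (a + a) (a + n) χ′ (proj₁ ∘ index) injective bounded positive ⟩
      ∑ (a + n) χ′                        ≡⟨ ∑-split a n χ′ ⟩
      ∑ a χ′ + ∑ n (λ i → χ′ (a + i))     ≤⟨ +-mono-≤ (∑-mono-≤ a low) (∑-mono-≤ n high) ⟩
      ∑ a (λ _ → 1) + ∑ n χ               ≡⟨ cong (_+ ∑ n χ) (trans (∑-const a 1) (*-identityʳ a)) ⟩
      a + ∑ n χ                           ∎)
      where
      open ≤-Reasoning
      low : ∀ i → i < a → χ′ i ≤ 1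
      low i i<a with i <? a
      ... | yes _   = ≤-refl
      ... | no  i≮a = contradiction i<a i≮a
      high : ∀ i → i < n → χ′ (a + i) ≤ χ i
      high i _ with a + i <? a
      ... | yes lt = contradiction lt (≤⇒≯ (m≤m+n a i))
      ... | no  _  = ≤-reflexive (cong χ (m+n∸m≡n a i))
      -- The value at argument 0 recovers the constant, which makes the choice of indices injective.
      const-at : ∀ {j e} → SameFn φ j (projF 0F) e → Eval φ (j ∷ 0 ∷ []) e
      const-at {e = e} same′ = proj₂ (same′ 0 e) ev-proj
      injective : ∀ d e → proj₁ (index d) ≡ proj₁ (index e) → d ≡ e
      injective d e eq = toℕ-injective (Eval-deterministic
        (subst (λ j → Eval φ (j ∷ 0 ∷ []) (toℕ d)) eq (const-at (proj₂ (proj₂ (proj₂ (index d))))))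
        (const-at (proj₂ (proj₂ (proj₂ (index e))))))
      bounded : ∀ e → proj₁ (index e) < a + n
      bounded e = begin-strict
        proj₁ (index e)          ≤⟨ proj₁ (proj₂ (index e)) ⟩
        f (toℕ e)                ≤⟨ f≤ (toℕ e) ⟩
        c * toℕ e + c            ≡⟨ trans (+-comm (c * toℕ e) c) (sym (*-suc c (toℕ e))) ⟩
        c * suc (toℕ e)          ≤⟨ *-monoʳ-≤ c (toℕ<n e) ⟩
        c * (a + a)              ≡⟨ solve 2 (λ c a → c :* (a :+ a) := con 2 :* c :* a) refl c a ⟩
        n                        <⟨ +-monoˡ-≤ n (0<a a e) ⟩
        a + n                    ∎
        where
        open +-*-Solver
        0<a : ∀ a → Fin (a + a) → 0 < a
        0<a (suc a) _ = s≤s z≤n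
      positive : ∀ e → 1 ≤ χ′ (proj₁ (index e))
      positive e with index e | bounded e
      ... | j , _ , min , _ | j< with j <? a
      ... | yes _   = ≤-refl
      ... | no  j≮a = χ-min (j ∸ a) (+-cancelˡ-< a _ _ (subst (_< a + n) (sym eq) j<)) (subst (MIN φ) (sym eq) min)
        where
        eq : a + (j ∸ a) ≡ j
        eq = m+[n∸m]≡n (≮⇒≥ j≮a)

-- The computable search for hitting sets

n<2^n : ∀ n → n < 2 ^ n
n<2^n zero    = ≤-refl
n<2^n (suc n) = begin-strict
  suc n              <⟨ s≤s (n<2^n n) ⟩
  suc (2 ^ n)        ≤⟨ +-monoˡ-≤ (2 ^ n) (m^n>0 2 n) ⟩
  2 ^ n + 2 ^ n      ≡⟨ cong (2 ^ n +_) (+-identityʳ (2 ^ n)) ⟨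
  2 ^ suc n          ∎
  where open ≤-Reasoning

does≡true⇒ : ∀ {P : Set} (P? : Dec P) → does P? ≡ true → P
does≡true⇒ (yes p) _ = p

distance : ℕ → ℕ → ℕ
distance x y = (x ∸ y) + (y ∸ x)

≡⇒distance≡0 : ∀ {x y} → x ≡ y → distance x y ≡ 0
≡⇒distance≡0 {x} refl = cong₂ _+_ (n∸n≡0 x) (n∸n≡0 x)

distance≡0⇒≡ : ∀ {x y} → distance x y ≡ 0 → x ≡ y
distance≡0⇒≡ {x} {y} eq = ≤-antisym (m∸n≡0⇒m≤n (m+n≡0⇒m≡0 (x ∸ y) eq)) (m∸n≡0⇒m≤n (m+n≡0⇒n≡0 (x ∸ y) eq))

computable-distance : Computable₂ distance
computable-distance = compose₂ _+_ computable-+ computable-∸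
  (compose₂ _∸_ computable-∸ (computable-lookup 1F) (computable-lookup 0F))

count : ℕ → ℕ → ℕ
count m D = ∑ m (λ i → bit i D)

computable-count : Computable₂ count
computable-count = computable-∑ (computable-lookup 0F)
  (compose₂ bit computable-bit (computable-lookup 0F) (computable-lookup 2F))

count-encode : ∀ {n} (D : Vec Bool n) → count n (encode D) ≡ size D
count-encode {n} D = ∑-cong n λ i _ → bit-encode i D

-- The square of the number of indices in block s, so that the values produced outgrow every linear
-- bound in the index.
origin : ℕ → ℕ
origin s = 2 ^ s * 2 ^ s

computable-origin : Computable₁ origin
computable-origin = compose₂ _*_ computable-* computable-2^ computable-2^

linear≤exponential : ∀ a b → ∃ λ s → s * a + b ≤ 2 ^ s
linear≤exponential a b = u + u , (begin
  -- The added summand is the exact difference from the square of `suc u`. Squaring `n<2^n` at u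
  -- supplies the quadratic growth that beats the linear term.
  (u + u) * a + b                                      ≤⟨ m≤m+n _ _ ⟩
  (u + u) * a + b + (b * u + 4 * a + b + 1)            ≡⟨ solve 2 (λ a b →
      let u = con 2 :* a :+ b in
      (u :+ u) :* a :+ b :+ (b :* u :+ con 4 :* a :+ b :+ con 1)
      := (con 1 :+ u) :* (con 1 :+ u)) refl a b ⟩
  suc u * suc u                                        ≤⟨ *-mono-≤ (n<2^n u) (n<2^n u) ⟩
  2 ^ u * 2 ^ u                                        ≡⟨ ^-distribˡ-+-* 2 u u ⟨
  2 ^ (u + u)                                          ∎)
  where
  open ≤-Reasoning
  open +-*-Solver
  u = 2 * a + b

-- Block s concerns the indices e = 2 ^ s + l with l < 2 ^ s and the window of the q * origin s
-- numbers from origin s on, represented by their offsets.  An offset set D is consistent if it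
-- does not contradict the predictions g on any tuple from the window.
module Search {k : ℕ} (g : Fin k → Vec ℕ k → ℕ) (computable-g : ∀ i → Computable (g i)) (q : ℕ) where

  width : ℕ → ℕ
  width s = q * origin s

  prediction : ∀ s → Vec ℕ k → Fin k → ℕ
  prediction s xs i = g i (tabulate λ j → origin s + lookup xs j)

  mismatch : Fin k → Vec ℕ (k + 2) → ℕ
  mismatch i zs = distance (bit (lookup zs (i ↑ˡ 2)) (lookup zs (k ↑ʳ 0F)))
    (g i (tabulate λ j → origin (lookup zs (k ↑ʳ 1F)) + lookup zs (j ↑ˡ 2)))

  violations : ℕ → ℕ → ℕ
  violations D s = ∑-tuples k (λ ys → width (lookup ys 1F)) (λ zs → ∏ (λ i → mismatch i zs)) (D ∷ s ∷ [])

  -- As 1 ∸ x is the indicator of x = 0, defect (G ∷ s ∷ []) vanishes iff G has at most 2 ^ s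
  -- elements in the window and meets every consistent D with at least origin s elements.
  missed : Vec ℕ 3 → ℕ
  missed ys = (1 ∸ violations D s) * (1 ∸ (origin s ∸ count (width s) D)) *
              (1 ∸ ∑ (width s) (λ i → bit i D * bit i G))
    where
    D = lookup ys 0F
    G = lookup ys 1F
    s = lookup ys 2F

  defect : Vec ℕ 2 → ℕ
  defect ys = ∑ (2 ^ width (lookup ys 1F)) (λ D → missed (D ∷ ys)) +
              (count (width (lookup ys 1F)) (lookup ys 0F) ∸ 2 ^ lookup ys 1F)

  computable-width : Computable₁ width
  computable-width = compose₂ _*_ computable-* (computable-const q) computable-origin

  computable-mismatch : ∀ i → Computable (mismatch i)
  computable-mismatch i = compose₂ distance computable-distance
    (compose₂ bit computable-bit (computable-lookup (i ↑ˡ 2)) (computable-lookup (k ↑ʳ 0F)))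
    (compose (computable-g i) λ j → compose₂ _+_ computable-+
      (compose₁ origin computable-origin (computable-lookup (k ↑ʳ 1F))) (computable-lookup (j ↑ˡ 2)))

  computable-violations : Computable₂ violations
  computable-violations = computable-cong (λ { (D ∷ s ∷ []) → refl })
    (computable-∑-tuples k (compose₁ width computable-width (computable-lookup 1F))
      (computable-∏ computable-mismatch))

  computable-missed : Computable missed
  computable-missed = compose₂ _*_ computable-* (compose₂ _*_ computable-*
    (1∸ compose₂ violations computable-violations D s)
    (1∸ compose₂ _∸_ computable-∸ (compose₁ origin computable-origin s)
          (compose₂ count computable-count window D)))
    (1∸ computable-∑ window (compose₂ _*_ computable-*
          (compose₂ bit computable-bit (computable-lookup 0F) (computable-lookup 1F))
          (compose₂ bit computable-bit (computable-lookup 0F) (computable-lookup 2F))))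
    where
    D = computable-lookup {3} 0F
    s = computable-lookup {3} 2F
    window = compose₁ width computable-width s
    1∸_ : ∀ {n} {f : Vec ℕ n → ℕ} → Computable f → Computable (λ xs → 1 ∸ f xs)
    1∸ c = compose₂ _∸_ computable-∸ (computable-const 1) c

  computable-defect : Computable defect
  computable-defect = compose₂ _+_ computable-+
    (computable-∑ (compose₁ (2 ^_) computable-2^ window) computable-missed)
    (compose₂ _∸_ computable-∸ (compose₂ count computable-count window (computable-lookup 0F))
      (compose₁ (2 ^_) computable-2^ (computable-lookup 1F)))
    where
    window = compose₁ width computable-width (computable-lookup {2} 1F)

  mismatch-++ : ∀ i xs D s → mismatch i (xs ++ D ∷ s ∷ []) ≡ distance (bit (lookup xs i) D) (prediction s xs i)
  mismatch-++ i xs D s = cong₂ distance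
    (cong₂ bit (lookup-++ˡ xs _ i) (lookup-++ʳ xs (D ∷ s ∷ []) 0F))
    (cong (g i) (tabulate-cong λ j → cong₂ _+_ (cong origin (lookup-++ʳ xs (D ∷ s ∷ []) 1F)) (lookup-++ˡ xs _ j)))

  violations≡0⇒ : ∀ D s → violations D s ≡ 0 → ∀ xs → All (_< width s) xs →
    ∃ λ i → bit (lookup xs i) D ≡ prediction s xs i
  violations≡0⇒ D s eq xs xs< with ∏≡0⇒∃≡0 _ (∑-tuples≡0⇒≡0 k eq xs xs<)
  ... | i , mismatch≡0 = i , distance≡0⇒≡ (trans (sym (mismatch-++ i xs D s)) mismatch≡0)

  ⇒violations≡0 : ∀ D s → (∀ xs → All (_< width s) xs →
    ∃ λ i → bit (lookup xs i) D ≡ prediction s xs i) → violations D s ≡ 0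
  ⇒violations≡0 D s agree = ≡0⇒∑-tuples≡0 k λ xs xs< → let i , eq = agree xs xs< in
    ≡0⇒∏≡0 _ i (trans (mismatch-++ i xs D s) (≡⇒distance≡0 eq))

  defect≡0⇒small : ∀ G s → defect (G ∷ s ∷ []) ≡ 0 → count (width s) G ≤ 2 ^ s
  defect≡0⇒small G s eq = m∸n≡0⇒m≤n (m+n≡0⇒n≡0 (∑ (2 ^ width s) _) eq)

  defect≡0⇒hits : ∀ G s → defect (G ∷ s ∷ []) ≡ 0 → ∀ D → D < 2 ^ width s →
    violations D s ≡ 0 → origin s ≤ count (width s) D →
    ∃ λ x → x < width s × bit x D * bit x G ≢ 0
  defect≡0⇒hits G s eq D D< consistent large = ∑≢0⇒∃≢0 (width s) λ sum≡0 →
    contradiction (begin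
      1                             ≡⟨⟩
      (1 ∸ 0) * (1 ∸ 0) * (1 ∸ 0)   ≡⟨ cong₂ _*_ (cong₂ (λ u v → (1 ∸ u) * (1 ∸ v)) consistent (m≤n⇒m∸n≡0 large))
                                                 (cong (1 ∸_) sum≡0) ⟨
      missed (D ∷ G ∷ s ∷ [])       ≡⟨ ∑≡0⇒≡0 (2 ^ width s) (m+n≡0⇒m≡0 _ eq) D D< ⟩
      0                             ∎) λ ()
    where open ≡-Reasoning

  -- The conditions tested by the first two factors of `missed`, recast as a family of subsets to
  -- which the counting lemmas apply.
  consistent-large : ∀ s → Family (width s)
  consistent-large s D = does (violations (encode D) s ≟ 0) ∧ does (origin s ≤? size D)

  consistent-large-sound : ∀ s D → consistent-large s D ≡ true → violations (encode D) s ≡ 0 × origin s ≤ size D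
  consistent-large-sound s D eq with v≡0 , le ← ∧-true (does (violations (encode D) s ≟ 0)) _ eq =
    does≡true⇒ (_ ≟ 0) v≡0 , does≡true⇒ (_ ≤? _) le

  consistent-large-complete : ∀ s D → violations (encode D) s ≡ 0 → origin s ≤ size D → consistent-large s D ≡ true
  consistent-large-complete s D v≡0 le = cong₂ _∧_ (dec-true (_ ≟ 0) v≡0) (dec-true (_ ≤? _) le)

  gates : ∀ u v w → (u ≡ 0 → v ≡ 0 → w ≢ 0) → (1 ∸ u) * (1 ∸ v) * (1 ∸ w) ≡ 0
  gates (suc u) v       w       w≢0 rewrite 0∸n≡0 u = refl
  gates zero    (suc v) w       w≢0 rewrite 0∸n≡0 v = refl
  gates zero    zero    zero    w≢0 = contradiction refl (w≢0 refl refl)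
  gates zero    zero    (suc w) w≢0 rewrite 0∸n≡0 w = refl

  -- The missed pattern is the complement of the prediction: a consistent set agrees with the
  -- prediction somewhere, hence differs from the complement there. Testing against 0 yields a
  -- different value from the prediction even when the prediction is not a bit.
  consistent-noShatter : ∀ s → NoShatter k (consistent-large s)
  consistent-noShatter s T = tabulate (λ i → prediction s xs i ≡ᵇ 0) , miss
    where
    xs : Vec ℕ k
    xs = map toℕ T
    xs< : All (_< width s) xs
    xs< = All.map⁺ (universal toℕ<n T)
    ⟦≡ᵇ0⟧≢ : ∀ v → ⟦ v ≡ᵇ 0 ⟧ ≢ v
    ⟦≡ᵇ0⟧≢ zero    ()
    ⟦≡ᵇ0⟧≢ (suc v) ()
    miss : ∀ D → consistent-large s D ≡ true → map (mem D ∘ toℕ) T ≢ tabulate (λ i → prediction s xs i ≡ᵇ 0)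
    miss D FD eq with violations≡0⇒ (encode D) s (proj₁ (consistent-large-sound s D FD)) xs xs<
    ... | i , agree = ⟦≡ᵇ0⟧≢ (prediction s xs i) (begin
      ⟦ prediction s xs i ≡ᵇ 0 ⟧                              ≡⟨ cong ⟦_⟧ (lookup∘tabulate (λ i → prediction s xs i ≡ᵇ 0) i) ⟨
      ⟦ lookup (tabulate (λ i → prediction s xs i ≡ᵇ 0)) i ⟧  ≡⟨ cong (λ v → ⟦ lookup v i ⟧) eq ⟨
      ⟦ lookup (map (mem D ∘ toℕ) T) i ⟧                      ≡⟨ cong ⟦_⟧ (lookup-map i (mem D ∘ toℕ) T) ⟩
      ⟦ mem D (toℕ (lookup T i)) ⟧                            ≡⟨ cong (⟦_⟧ ∘ mem D) (lookup-map i toℕ T) ⟨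
      ⟦ mem D (lookup xs i) ⟧                                 ≡⟨ bit-encode (lookup xs i) D ⟨
      bit (lookup xs i) (encode D)                            ≡⟨ agree ⟩
      prediction s xs i                                       ∎)
      where open ≡-Reasoning

  -- The window is shorter than 2 to the power `q + (s + s)`, so k times this exponent bounds the
  -- logarithm of the family. One more halving makes the bound strict, and each halving costs q
  -- elements.
  hitting-set-cost : ℕ → ℕ
  hitting-set-cost s = suc ((q + (s + s)) * k) * q

  -- The cost is linear in s. The parameter r leaves room for the constant of the linear bound on
  -- `hitter`, which is known only after that program is fixed.
  affordable-level : ∀ r → ∃ λ s → hitting-set-cost s ≤ 2 ^ s × r ≤ 2 ^ s
  affordable-level r with s , le ← linear≤exponential (2 * (k * q)) (suc (q * k) * q + r) =
    s , ≤-trans (m≤m+n _ r) (regrouped s le) , ≤-trans (m≤n+m r (hitting-set-cost s)) (regrouped s le)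
    where
    open +-*-Solver
    regrouped : ∀ s {t} → s * (2 * (k * q)) + (suc (q * k) * q + r) ≤ t → hitting-set-cost s + r ≤ t
    regrouped s {t} = subst (_≤ t) (solve 4 (λ s k q r →
      s :* (con 2 :* (k :* q)) :+ ((con 1 :+ q :* k) :* q :+ r)
      := (con 1 :+ (q :+ (s :+ s)) :* k) :* q :+ r) refl s k q r)

  defect-zero : 0 < q → ∀ s → hitting-set-cost s ≤ 2 ^ s → ∃ λ G → defect (G ∷ s ∷ []) ≡ 0
  defect-zero 0<q s cost≤ with small-hitting-set q (origin s) 0<width ≤-refl (suc (L * k)) F
      (λ D FD → proj₂ (consistent-large-sound s D FD)) card<
    where
    open ≤-Reasoning
    L = q + (s + s)
    F = consistent-large s
    0<origin : 0 < origin s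
    0<origin = *-mono-≤ (m^n>0 2 s) (m^n>0 2 s)
    0<width : 0 < width s
    0<width = *-mono-≤ 0<q 0<origin
    width< : width s < 2 ^ L
    width< = begin-strict
      q * origin s            <⟨ *-monoˡ-< (origin s) ⦃ >-nonZero 0<origin ⦄ (n<2^n q) ⟩
      2 ^ q * origin s        ≡⟨ cong (2 ^ q *_) (^-distribˡ-+-* 2 s s) ⟨
      2 ^ q * 2 ^ (s + s)    ≡⟨ ^-distribˡ-+-* 2 q (s + s) ⟨
      2 ^ L                  ∎
    card< : card F < 2 ^ suc (L * k)
    card< = begin-strict
      card F                 ≤⟨ sauer-shelah k F (consistent-noShatter s) ⟩
      suc (width s) ^ k      ≤⟨ ^-monoˡ-≤ k width< ⟩
      (2 ^ L) ^ k            ≡⟨ ^-*-assoc 2 L k ⟩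
      2 ^ (L * k)            <⟨ ^-monoʳ-< 2 ≤-refl (n<1+n (L * k)) ⟩
      2 ^ suc (L * k)        ∎
  ... | H , size-H , hit = encode H , cong₂ _+_ (≡0⇒∑≡0 (2 ^ width s) caught)
      (m≤n⇒m∸n≡0 (≤-trans (≤-reflexive (count-encode H)) (≤-trans size-H cost≤)))
    where
    caught : ∀ D → D < 2 ^ width s → missed (D ∷ encode H ∷ s ∷ []) ≡ 0
    caught D D< with V , refl ← encode-surjective (width s) D D< =
      gates (violations (encode V) s) _ _ λ consistent large → sum≢0 V
        (consistent-large-complete s V consistent (subst (origin s ≤_) (count-encode V) (m∸n≡0⇒m≤n large)))
      where
      sum≢0 : ∀ V → consistent-large s V ≡ true → ∑ (width s) (λ i → bit i (encode V) * bit i (encode H)) ≢ 0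
      sum≢0 V FV sum≡0 with x , x< , x∈V , x∈H ← hit V FV = contradiction (begin
        1                                       ≡⟨⟩
        ⟦ true ⟧ * ⟦ true ⟧                     ≡⟨ cong₂ (λ a b → ⟦ a ⟧ * ⟦ b ⟧) x∈V x∈H ⟨
        ⟦ mem V x ⟧ * ⟦ mem H x ⟧               ≡⟨ cong₂ _*_ (bit-encode x V) (bit-encode x H) ⟨
        bit x (encode V) * bit x (encode H)     ≡⟨ ∑≡0⇒≡0 (width s) sum≡0 x x< ⟩
        0                                       ∎) λ ()
        where open ≡-Reasoning

  -- Its least zero in the first argument is the binary logarithm, rounded down, of a positive
  -- second argument; this recovers the block of an index.
  level-test : Vec ℕ 2 → ℕ
  level-test ys = suc (lookup ys 1F) ∸ 2 ^ suc (lookup ys 0F)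

  computable-level-test : Computable level-test
  computable-level-test = compose₂ _∸_ computable-∸ (compose₁ suc computable-suc (computable-lookup 1F))
    (compose₁ (2 ^_) computable-2^ (compose₁ suc computable-suc (computable-lookup 0F)))

  -- Its least zero in the first argument is the position where the count of elements first exceeds
  -- the rank, hence the element of that rank, counted from 0.
  element-test : Vec ℕ 3 → ℕ
  element-test ys = suc (lookup ys 1F) ∸ count (suc (lookup ys 0F)) (lookup ys 2F)

  computable-element-test : Computable element-test
  computable-element-test = compose₂ _∸_ computable-∸ (compose₁ suc computable-suc (computable-lookup 1F))
    (compose₂ count computable-count (compose₁ suc computable-suc (computable-lookup 0F)) (computable-lookup 2F))

  -- Sends 2 ^ s + l to origin s plus the element number l (from 0) of the first G without defect.
  hitter : PR 1
  hitter = compF (program computable-+) (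
    compF (program computable-origin) (level ∷ []) ∷
    compF (minF (program computable-element-test)) (
      compF (program computable-∸) (projF 0F ∷ compF (program computable-2^) (level ∷ []) ∷ []) ∷
      compF (minF (program computable-defect)) (level ∷ []) ∷ []) ∷ [])
    where
    level : PR 1
    level = minF (program computable-level-test)

  eval-hitter : ∀ s G → defect (G ∷ s ∷ []) ≡ 0 → (∀ G′ → G′ < G → defect (G′ ∷ s ∷ []) ≢ 0) →
    ∀ x → bit x G ≢ 0 → count x G < 2 ^ s →
    Eval hitter ((2 ^ s + count x G) ∷ []) (origin s + x)
  eval-hitter s G zero-at least x x∈G l< =
    ev-comp (ev-comp (ev-level ∷ []) (computes computable-origin _) ∷
             ev-comp (ev-comp (ev-proj ∷ ev-comp (ev-level ∷ []) (computes computable-2^ _) ∷ [])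
                              (subst (Eval _ _) (m+n∸m≡n (2 ^ s) l) (computes computable-∸ _)) ∷
                      ev-comp (ev-level ∷ []) (eval-minF computable-defect _ G zero-at least) ∷ [])
                     (eval-minF computable-element-test _ x found earlier) ∷ [])
            (computes computable-+ _)
    where
    open ≤-Reasoning
    l = count x G
    e = 2 ^ s + l
    found : suc l ∸ count (suc x) G ≡ 0
    found = m≤n⇒m∸n≡0 (begin
      suc l           ≡⟨ +-comm 1 l ⟩
      l + 1           ≤⟨ +-monoʳ-≤ l (n≢0⇒n>0 x∈G) ⟩
      l + bit x G     ∎)
    -- Up to a position before x, at most the l elements preceding x have been counted.
    earlier : ∀ z → z < x → suc l ∸ count (suc z) G ≢ 0
    earlier z z<x = m>n⇒m∸n≢0 (s≤s (∑-mono-bound (λ i → bit i G) z<x))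
    ev-level : Eval (minF (program computable-level-test)) (e ∷ []) s
    ev-level = eval-minF computable-level-test _ s
      (m≤n⇒m∸n≡0 (begin
        suc e             ≡⟨ +-suc (2 ^ s) l ⟨
        2 ^ s + suc l     ≤⟨ +-monoʳ-≤ (2 ^ s) l< ⟩
        2 ^ s + 2 ^ s     ≡⟨ cong (2 ^ s +_) (+-identityʳ (2 ^ s)) ⟨
        2 ^ suc s         ∎))
      λ z z<s → m>n⇒m∸n≢0 (s≤s (≤-trans (^-monoʳ-≤ 2 z<s) (m≤m+n (2 ^ s) l)))

  -- The level s is fixed before D is given, so D may be the trace of an undecidable set on the
  -- window, known only under double negation.
  hitter-hits : 0 < q → ∀ r → ∃ λ s → r ≤ 2 ^ s ×
    (∀ D → D < 2 ^ width s → violations D s ≡ 0 → origin s ≤ count (width s) D →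
      ∃ λ x → x < width s × bit x D ≢ 0 ×
        ∃ λ l → l < 2 ^ s × Eval hitter ((2 ^ s + l) ∷ []) (origin s + x))
  hitter-hits 0<q r = at-level (affordable-level r)
    where
    at-level : _ → _
    at-level (s , cost≤ , r≤) = s , r≤ , λ D D< consistent large →
      hit D (defect≡0⇒hits G s zero-at D D< consistent large)
      where
      -- Minimization returns the least code without defect, which need not be the code of the
      -- greedy hitting set.
      first = least-zero (λ G → defect (G ∷ s ∷ [])) (proj₁ (defect-zero 0<q s cost≤)) (proj₂ (defect-zero 0<q s cost≤))
      G = proj₁ first
      zero-at = proj₁ (proj₂ first)

      rank< : ∀ x → x < width s → bit x G ≢ 0 → count x G < 2 ^ s
      rank< x x< bit≢0 = begin
        suc (count x G)        ≡⟨ +-comm 1 (count x G) ⟩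
        count x G + 1          ≤⟨ +-monoʳ-≤ (count x G) (n≢0⇒n>0 bit≢0) ⟩
        count (suc x) G        ≤⟨ ∑-mono-bound (λ i → bit i G) x< ⟩
        count (width s) G      ≤⟨ defect≡0⇒small G s zero-at ⟩
        2 ^ s                  ∎
        where open ≤-Reasoning

      hit : ∀ D → (∃ λ x → x < width s × bit x D * bit x G ≢ 0) →
        ∃ λ x → x < width s × bit x D ≢ 0 × ∃ λ l → l < 2 ^ s × Eval hitter ((2 ^ s + l) ∷ []) (origin s + x)
      hit D (x , x< , both) = x , x< , (λ eq → both (cong (_* bit x G) eq)) ,
        count x G , rank< x x< x∈G , eval-hitter s G zero-at (proj₂ (proj₂ first)) x x∈G (rank< x x< x∈G)
        where
        x∈G : bit x G ≢ 0
        x∈G eq = both (trans (cong (bit x D *_) eq) (*-zeroʳ (bit x D)))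

-- Quadratic values against the linear bound

linear<square : ∀ c m e → e < m + m → suc (c * 3) ≤ m → c * e + c < m * m
linear<square c m e e< 3c<m = begin-strict
  c * e + c           ≡⟨ trans (+-comm (c * e) c) (sym (*-suc c e)) ⟩
  c * suc e           ≤⟨ *-monoʳ-≤ c e< ⟩
  c * (m + m)         ≤⟨ m≤m+n _ (c * m) ⟩
  c * (m + m) + c * m ≡⟨ solve 2 (λ c m → c :* (m :+ m) :+ c :* m := c :* con 3 :* m) refl c m ⟩
  c * 3 * m           <⟨ *-monoˡ-< m ⦃ >-nonZero (≤-trans (s≤s z≤n) 3c<m) ⦄ 3c<m ⟩
  m * m               ∎
  where
  open ≤-Reasoning
  open +-*-Solver

mem-tabulate : ∀ {n} (f : Fin n → Bool) i → mem (tabulate f) (toℕ i) ≡ f i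
mem-tabulate f zero    = refl
mem-tabulate f (suc i) = mem-tabulate (f ∘ suc) i

does-reflects : ∀ {P : Set} (P? : Dec P) {b} → (b ≡ 1 × P) ⊎ (b ≡ 0 × ¬ P) → ⟦ does P? ⟧ ≡ b
does-reflects (yes p) (inj₁ (refl , _)) = refl
does-reflects (yes p) (inj₂ (_ , ¬p))   = contradiction p ¬p
does-reflects (no ¬p) (inj₁ (_ , p))    = contradiction p ¬p
does-reflects (no ¬p) (inj₂ (refl , _)) = refl

theorem3p3 : ∀ (φ : Numbering) → Kolmogorov φ →
    ∀ (k : ℕ) → 1 ≤ k → ¬ OneKRecursive (MIN φ) k
theorem3p3 φ kolmogorov k _ (predictor , predicts)
  with minimal-indices-dense φ kolmogorov
... | c , 0<c , dense = refute (computed-minimal-index-bound φ kolmogorov hitter)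
  where
  g : Fin k → Vec ℕ k → ℕ
  g i xs = proj₁ (proj₁ (predicts xs) i)
  -- This makes `width s` the window length of `minimal-indices-dense` for a equal to `origin s`.
  q = 2 * c
  open Search g (λ i → computable (predictor i) λ xs → proj₁ (proj₂ (proj₁ (predicts xs) i))) q

  module Window (s : ℕ) (minimal? : (i : Fin (width s)) → Dec (MIN φ (origin s + toℕ i))) where

    characteristic : Vec Bool (width s)
    characteristic = tabulate (does ∘ minimal?)
    D = encode characteristic

    minimal?-at : ∀ x → x < width s → ∃ λ (d : Dec (MIN φ (origin s + x))) → bit x D ≡ ⟦ does d ⟧
    minimal?-at x x< = at-index (fromℕ< x<) (toℕ-fromℕ< x<)
      where
      at-index : ∀ {x} (i : Fin (width s)) → toℕ i ≡ x → ∃ λ (d : Dec (MIN φ (origin s + x))) → bit x D ≡ ⟦ does d ⟧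
      at-index i refl =
        minimal? i , trans (bit-encode (toℕ i) characteristic) (cong ⟦_⟧ (mem-tabulate (does ∘ minimal?) i))

    -- The true trace is a candidate: on the shifted tuple the predictor is right at some position,
    -- and determinism identifies its output there with the value of `g`.
    consistent : violations D s ≡ 0
    consistent = ⇒violations≡0 D s λ xs xs< →
      let ys = tabulate (λ j → origin s + lookup xs j)
          total , i , b , ev , agrees = predicts ys
          d , bit≡ = minimal?-at (lookup xs i) (All.lookup⁺ xs< i)
      in i , trans bit≡ (trans
        (does-reflects d (subst (λ y → AgreesChar (MIN φ) y b) (lookup∘tabulate _ i) agrees))
        (Eval-deterministic ev (proj₁ (proj₂ (total i)))))

    large : origin s ≤ count (width s) D
    large = dense (origin s) (λ x → bit x D) λ x x< min → let d , bit≡ = minimal?-at x x< in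
      ≤-reflexive (sym (trans bit≡ (does-reflects d (inj₁ (refl , min)))))

    bit⇒minimal : ∀ x → x < width s → bit x D ≢ 0 → MIN φ (origin s + x)
    bit⇒minimal x x< bit≢0 with minimal?-at x x<
    ... | yes min , _    = min
    ... | no  _   , bit≡ = contradiction bit≡ bit≢0

  refute : ¬ (∃ λ c → ∀ e y → Eval hitter (e ∷ []) y → MIN φ y → y ≤ c * e + c)
  refute (c₁ , bound) = at-level (hitter-hits (≤-trans 0<c (m≤m+n c _)) (suc (c₁ * 3)))
    where
    at-level : ¬ _
    -- The goal is a contradiction, so minimality may be taken as decided at all of the finitely
    -- many positions of the window. The threshold `suc (c₁ * 3)` passed for r is the one that
    -- `linear<square` asks of `2 ^ s`.
    at-level (s , 3c₁< , hits) = ¬¬-sequence (λ i → ¬¬-excluded-middle) λ minimal? →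
      let open Window s minimal?
          x , x< , x∈D , l , l< , ev = hits D (encode<2^n characteristic) consistent large
      in <⇒≱ (linear<square c₁ (2 ^ s) (2 ^ s + l) (+-monoʳ-< (2 ^ s) l<) 3c₁<)
        (≤-trans (m≤m+n (origin s) x) (bound (2 ^ s + l) (origin s + x) ev (bit⇒minimal x x< x∈D)))
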